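{- Let $M$ be a matroid of rank $r$ and let $C_1,C_2$ be circuits of $M$ with $|C_1|=r+1$ and $|C_2|<r+1$. Then $\beta_{C_1}<\beta_{C_2}$.
   Context: Matroid bingo: let $M$ be a matroid on a finite set $E$ with $|E|=n$ and circuit set $\mathcal{C}$. The elements of $E$ are called out one at a time in a uniformly random order $\sigma(1),\sigma(2),\dots,\sigma(n)$ (a uniformly random permutation of $E$). A circuit $C$ wins in round $t$ if $C\subseteq\{\sigma(1),\dots,\sigma(t)\}$ and no circuit of $M$ is contained in $\{\sigma(1),\dots,\sigma(t-1)\}$; thus the winner is the first circuit to be completed (the circuit axioms guarantee that there is no tie). $\beta_C$ denotes the probability that $C$ wins (in some round). -}

module Defs where

open import Data.Fin.Base using (Fin; toℕ)
import Data.Fin.Properties as Fin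
open import Data.Fin.Subset
  using (Subset; ⊥; ⁅_⁆; ⋃; _∪_; _∈_; _∉_; _⊆_; _⊂_; ∣_∣)
open import Data.Fin.Subset.Properties using (_⊆?_; _⊂?_; anySubset?)
open import Data.Integer.Base using (+_)
open import Data.List.Base as List
  using (List; []; _∷_; length; filter; allFin; cartesianProductWith)
open import Data.List.Membership.Propositional as ListMem using ()
open import Data.List.Membership.Propositional.Properties
  using (∈-allFin; ∈-cartesianProductWith⁺; ∈-filter⁺; ∈-filter⁻; ∈-length)
open import Data.List.Relation.Unary.All as All using ()
open import Data.List.Relation.Unary.AllPairs as AllPairs using ()
open import Data.List.Relation.Unary.Any using (here)
open import Data.List.Relation.Unary.Unique.Propositional
  using () renaming (Unique to UniqueList)
open import Data.List.Relation.Unary.Unique.Propositional.Properties as UniqueList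
  using ()
open import Data.Nat.Base using (ℕ; zero; suc; _<_; NonZero; >-nonZero)
open import Data.Product.Base using (∃; _×_; _,_; proj₂)
open import Data.Rational.Base using (ℚ; _/_)
open import Data.Vec.Base using (Vec; []; _∷_; toList)
open import Data.Vec.Properties using (∷-injective)
open import Data.Vec.Relation.Unary.AllPairs using (allPairs?)
open import Data.Vec.Relation.Unary.Unique.Propositional using (Unique)
open import Data.Vec.Relation.Unary.Unique.Propositional.Properties using (tabulate⁺)
open import Function.Base using (id)
open import Relation.Binary.PropositionalEquality.Core using (_≡_; refl)
open import Relation.Nullary.Decidable using (¬?; _×-dec_; map′; decidable-stable)
open import Relation.Nullary.Negation.Core using (¬_)
open import Relation.Unary using (Decidable)

private
  variable
    n : ℕ

-- Independence is required to be decidable, as is automatic classically;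
-- this is what makes the counting in β below possible.

record Matroid (n : ℕ) : Set₁ where
  field
    Indep   : Subset n → Set
    indep?  : Decidable Indep
    ⊥-indep : Indep ⊥
    ⊆-indep : ∀ {I J} → I ⊆ J → Indep J → Indep I
    augment : ∀ {I J} → Indep I → Indep J → ∣ I ∣ < ∣ J ∣ →
              ∃ λ e → e ∈ J × e ∉ I × Indep (I ∪ ⁅ e ⁆)

  IsBasis : Subset n → Set
  IsBasis B = Indep B × (∀ {J} → B ⊂ J → ¬ Indep J)

  HasRank : ℕ → Set
  HasRank r = ∃ λ B → IsBasis B × ∣ B ∣ ≡ r

  IsCircuit : Subset n → Set
  IsCircuit C = ¬ Indep C × (∀ {D} → D ⊂ C → Indep D)

  isCircuit? : Decidable IsCircuit
  isCircuit? C = ¬? (indep? C) ×-dec map′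
    (λ none {D} D⊂C → decidable-stable (indep? D) λ ¬ID → none (D , D⊂C , ¬ID))
    (λ all (D , D⊂C , ¬ID) → ¬ID (all D⊂C))
    (¬? (anySubset? λ D → (D ⊂? C) ×-dec ¬? (indep? D)))

  ContainsCircuit : Subset n → Set
  ContainsCircuit S = ∃ λ D → IsCircuit D × D ⊆ S

  containsCircuit? : Decidable ContainsCircuit
  containsCircuit? S = anySubset? λ D → isCircuit? D ×-dec (D ⊆? S)

open Matroid public using (HasRank; IsCircuit)

tuples : ∀ {A : Set} → List A → ∀ k → List (Vec A k)
tuples xs zero    = [] ∷ []
tuples xs (suc k) = cartesianProductWith _∷_ xs (tuples xs k)

-- A calling order is the sequence σ(1), …, σ(n) of values of a permutation
-- of Fin n, that is, a repetition-free vector of length n.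

unique? : ∀ {k} → Decidable (Unique {A = Fin n} {n = k})
unique? = allPairs? λ x y → ¬? (x Fin.≟ y)

orders : ∀ n → List (Vec (Fin n) n)
orders n = filter unique? (tuples (allFin n) n)

∈-tuples : ∀ {k} (σ : Vec (Fin n) k) → σ ListMem.∈ tuples (allFin n) k
∈-tuples []      = here refl
∈-tuples (x ∷ σ) = ∈-cartesianProductWith⁺ _∷_ (∈-allFin x) (∈-tuples σ)

tuples-unique : ∀ n k → UniqueList (tuples (allFin n) k)
tuples-unique n zero    = All.[] AllPairs.∷ AllPairs.[]
tuples-unique n (suc k) =
  UniqueList.cartesianProductWith⁺ _∷_ ∷-injective
    (UniqueList.allFin⁺ n) (tuples-unique n k)

∈-orders⁺ : {σ : Vec (Fin n) n} → Unique σ → σ ListMem.∈ orders n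
∈-orders⁺ {σ = σ} σ! = ∈-filter⁺ unique? (∈-tuples σ) σ!

∈-orders⁻ : {σ : Vec (Fin n) n} → σ ListMem.∈ orders n → Unique σ
∈-orders⁻ {n} σ∈ = proj₂ (∈-filter⁻ unique? {xs = tuples (allFin n) n} σ∈)

orders-unique : ∀ n → UniqueList (orders n)
orders-unique n = UniqueList.filter⁺ unique? (tuples-unique n n)

orders-nonZero : ∀ n → NonZero (length (orders n))
orders-nonZero n = >-nonZero (∈-length (∈-orders⁺ {n} (tabulate⁺ {f = id} id)))

called : Vec (Fin n) n → ℕ → Subset n
called σ t = ⋃ (List.map ⁅_⁆ (List.take t (toList σ)))

module _ (M : Matroid n) where
  open Matroid M using (ContainsCircuit; containsCircuit?)

  -- i : Fin n encodes round t = suc (toℕ i), so that 1 ≤ t ≤ n.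
  WinsInRound : Subset n → Vec (Fin n) n → Fin n → Set
  WinsInRound C σ i =
    C ⊆ called σ (suc (toℕ i)) × ¬ ContainsCircuit (called σ (toℕ i))

  Wins : Subset n → Vec (Fin n) n → Set
  Wins C σ = ∃ λ i → WinsInRound C σ i

  wins? : ∀ C → Decidable (Wins C)
  wins? C σ = Fin.any? λ i →
    (C ⊆? called σ (suc (toℕ i))) ×-dec ¬? (containsCircuit? (called σ (toℕ i)))

  β : Subset n → ℚ
  β C = + length (filter (wins? C) (orders n)) / length (orders n)
    where instance _ = orders-nonZero n

{-# OPTIONS --safe #-}

-- A spanning circuit can only win when the first r + 1 calls are exactly its
-- elements.  Extend C₂ to a set S of size r + 1 in which deleting any element
-- of C₂ leaves an independent set: C₂ wins whenever the first r + 1 calls make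
-- up S.  Relabelling along an injection that carries C₁ onto S therefore
-- embeds the orders won by C₁ into those won by C₂.  An order that calls C₂
-- first and then some x ∈ C₁ ∖ S is also won by C₂, but is not in the image.

module Submission where

open import Defs
open import Data.Fin.Base using (Fin; zero; suc; toℕ; fromℕ<; punchIn)
import Data.Fin.Properties as Fin
open import Data.Fin.Permutation.Components using (transpose; transpose-inverse)
open import Data.Fin.Subset
  using (Subset; inside; outside; ⋃; ⁅_⁆; _∪_; _-_; _∈_; _∉_; _⊆_; _⊂_; ∣_∣; Nonempty)
open import Data.Fin.Subset.Properties
open import Data.Fin.Subset.Induction using (⊂-wellFounded; Acc; acc)
import Data.Integer.Base as ℤ
import Data.Integer.Properties as ℤ
open import Data.List.Base as List using (List; []; _∷_; length; filter)
import Data.List.Properties as List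
open import Data.List.Membership.Propositional as ListMem using ()
open import Data.List.Membership.Propositional.Properties
  using (∈-map⁻; ∈-filter⁺; ∈-filter⁻; ∈-lookup)
open import Data.List.Relation.Binary.Subset.Propositional
  using () renaming (_⊆_ to _⊆ᴸ_)
open import Data.List.Relation.Unary.All as All using ()
open import Data.List.Relation.Unary.All.Properties using (map⁺)
open import Data.List.Relation.Unary.AllPairs using ([]; _∷_)
open import Data.List.Relation.Unary.Any as Any using (here; there)
open import Data.List.Relation.Unary.Any.Properties using (lookup-index)
open import Data.List.Relation.Unary.Unique.Propositional
  using () renaming (Unique to UniqueList)
open import Data.List.Relation.Unary.Unique.Propositional.Properties as UniqueList
  using ()
open import Data.Nat.Base as ℕ
  using (ℕ; zero; suc; z≤n; s≤s; s<s⁻¹; s≤s⁻¹; _≤_; _<_; _∸_; NonZero)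
import Data.Nat.Properties as ℕ
open import Data.Product.Base using (∃; _×_; _,_; proj₁; proj₂)
open import Data.Rational.Base as ℚ using (ℚ)
import Data.Rational.Properties as ℚ
import Data.Rational.Unnormalised.Base as ℚᵘ
import Data.Rational.Unnormalised.Properties as ℚᵘ
open import Data.Sum.Base using (inj₁; inj₂; [_,_]′)
open import Data.Vec.Base as Vec using (Vec; []; _∷_; lookup; toList; removeAt)
import Data.Vec.Properties as Vec
open import Data.Vec.Relation.Unary.All.Properties using (toList⁺)
open import Data.Vec.Relation.Unary.AllPairs using ([]; _∷_)
open import Data.Vec.Relation.Unary.Unique.Propositional using (Unique)
open import Data.Vec.Relation.Unary.Unique.Propositional.Properties as Unique
  using ()
open import Function.Base using (id; _∘_)
open import Function.Definitions using (Injective)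
open import Relation.Binary.PropositionalEquality
  using (_≡_; _≢_; refl; sym; trans; cong; cong₂; subst; module ≡-Reasoning)
open import Relation.Nullary.Decidable using (yes; no; decidable-stable; ¬?; _×-dec_)
open import Relation.Nullary.Negation.Core using (¬_; contradiction)

private
  variable
    n : ℕ

-- Finite subsets: inclusion, cardinality and deletion

⊈⇒∃∉ : {p q : Subset n} → ¬ p ⊆ q → ∃ λ x → x ∈ p × x ∉ q
⊈⇒∃∉ {p = p} {q} p⊈q with Fin.any? (λ x → (x ∈? p) ×-dec ¬? (x ∈? q))
... | yes witness = witness
... | no none = contradiction
  (λ {x} x∈p → decidable-stable (x ∈? q) λ x∉q → none (x , x∈p , x∉q)) p⊈q

p⊆q∧∣q∣≤∣p∣⇒q⊆p : {p q : Subset n} → p ⊆ q → ∣ q ∣ ≤ ∣ p ∣ → q ⊆ p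
p⊆q∧∣q∣≤∣p∣⇒q⊆p {p = p} p⊆q ∣q∣≤∣p∣ {x} x∈q = decidable-stable (x ∈? p)
  λ x∉p → ℕ.≤⇒≯ ∣q∣≤∣p∣ (p⊂q⇒∣p∣<∣q∣ (p⊆q , x , x∈q , x∉p))

∣p∪⁅x⁆∣≡1+∣p∣ : ∀ {p : Subset n} {x} → x ∉ p → ∣ p ∪ ⁅ x ⁆ ∣ ≡ suc ∣ p ∣
∣p∪⁅x⁆∣≡1+∣p∣ {p = inside  ∷ p} {zero}  x∉p = contradiction Vec.here x∉p
∣p∪⁅x⁆∣≡1+∣p∣ {p = outside ∷ p} {zero}  x∉p = cong (suc ∘ ∣_∣) (∪-identityʳ p)
∣p∪⁅x⁆∣≡1+∣p∣ {p = inside  ∷ p} {suc x} x∉p = cong suc (∣p∪⁅x⁆∣≡1+∣p∣ (x∉p ∘ Vec.there))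
∣p∪⁅x⁆∣≡1+∣p∣ {p = outside ∷ p} {suc x} x∉p = ∣p∪⁅x⁆∣≡1+∣p∣ (x∉p ∘ Vec.there)

x∈p-y⇒x≢y : ∀ (p : Subset n) {x y} → x ∈ p - y → x ≢ y
x∈p-y⇒x≢y (_ ∷ p) {suc x} (Vec.there x∈) refl = x∈p-y⇒x≢y p x∈ refl
x∈p-y⇒x≢y (inside ∷ p) {zero} () refl
x∈p-y⇒x≢y (outside ∷ p) {zero} () refl

-y-mono-⊆ : ∀ {p q : Subset n} y → p ⊆ q → p - y ⊆ q - y
-y-mono-⊆ {p = p} y p⊆q x∈ = x∈p∧x≢y⇒x∈p-y (p⊆q (p─q⊆p p _ x∈)) (x∈p-y⇒x≢y p x∈)

p-x⊆q⇒p⊆q : ∀ {p q : Subset n} {x} → x ∈ q → p - x ⊆ q → p ⊆ q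
p-x⊆q⇒p⊆q {x = x} x∈q p-x⊆q {y} y∈p with y Fin.≟ x
... | yes refl = x∈q
... | no y≢x = p-x⊆q (x∈p∧x≢y⇒x∈p-y y∈p y≢x)

-- Called sets

∈-⋃⁺ : ∀ {x : Fin n} {xs} → x ListMem.∈ xs → x ∈ ⋃ (List.map ⁅_⁆ xs)
∈-⋃⁺ (here refl)  = x∈p∪q⁺ (inj₁ (x∈⁅x⁆ _))
∈-⋃⁺ (there x∈xs) = x∈p∪q⁺ (inj₂ (∈-⋃⁺ x∈xs))

∈-⋃⁻ : ∀ {x : Fin n} xs → x ∈ ⋃ (List.map ⁅_⁆ xs) → x ListMem.∈ xs
∈-⋃⁻ []       x∈ = contradiction x∈ ∉⊥
∈-⋃⁻ (y ∷ xs) x∈ with x∈p∪q⁻ ⁅ y ⁆ _ x∈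
... | inj₁ x∈⁅y⁆ = here (x∈⁅y⁆⇒x≡y y x∈⁅y⁆)
... | inj₂ x∈⋃   = there (∈-⋃⁻ xs x∈⋃)

∣⋃∣≡length : ∀ {xs : List (Fin n)} → UniqueList xs →
             ∣ ⋃ (List.map ⁅_⁆ xs) ∣ ≡ length xs
∣⋃∣≡length {n} []    = ∣⊥∣≡0 n
∣⋃∣≡length {xs = x ∷ xs} xs!@(_ ∷ xs!′) = begin
  ∣ ⁅ x ⁆ ∪ ⋃ (List.map ⁅_⁆ xs) ∣ ≡⟨ cong ∣_∣ (∪-comm ⁅ x ⁆ _) ⟩
  ∣ ⋃ (List.map ⁅_⁆ xs) ∪ ⁅ x ⁆ ∣ ≡⟨ ∣p∪⁅x⁆∣≡1+∣p∣ (UniqueList.Unique[x∷xs]⇒x∉xs xs! ∘ ∈-⋃⁻ xs) ⟩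
  suc ∣ ⋃ (List.map ⁅_⁆ xs) ∣     ≡⟨ cong suc (∣⋃∣≡length xs!′) ⟩
  suc (length xs)                 ∎
  where open ≡-Reasoning

module _ {A : Set} where

  ∈-take⁺ : ∀ {m t} (xs : Vec A m) i → toℕ i < t →
            lookup xs i ListMem.∈ List.take t (toList xs)
  ∈-take⁺ {t = suc t} (x ∷ xs) zero    _   = here refl
  ∈-take⁺ {t = suc t} (x ∷ xs) (suc i) i<t = there (∈-take⁺ xs i (s<s⁻¹ i<t))

  ∈-take⁻ : ∀ {m x} t (xs : Vec A m) → x ListMem.∈ List.take t (toList xs) →
            ∃ λ i → toℕ i < t × lookup xs i ≡ x
  ∈-take⁻ (suc t) (x ∷ xs) (here refl) = zero , s≤s z≤n , refl
  ∈-take⁻ (suc t) (x ∷ xs) (there x∈) with i , i<t , eq ← ∈-take⁻ t xs x∈ =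
    suc i , s≤s i<t , eq
  ∈-take⁻ (suc t) [] ()

  toList-unique : ∀ {m} {xs : Vec A m} → Unique xs → UniqueList (toList xs)
  toList-unique []         = []
  toList-unique (px ∷ xs!) = toList⁺ px ∷ toList-unique xs!

called⁺ : ∀ t (σ : Vec (Fin n) n) {i} → toℕ i < t → lookup σ i ∈ called σ t
called⁺ t σ {i} = ∈-⋃⁺ ∘ ∈-take⁺ σ i

called⁻ : ∀ t (σ : Vec (Fin n) n) {x} → x ∈ called σ t →
          ∃ λ i → toℕ i < t × lookup σ i ≡ x
called⁻ t σ = ∈-take⁻ t σ ∘ ∈-⋃⁻ _

called-mono : ∀ {s t} (σ : Vec (Fin n) n) → s ≤ t → called σ s ⊆ called σ t
called-mono {s = s} {t} σ s≤t x∈ with i , i<s , refl ← called⁻ s σ x∈ = called⁺ t σ (ℕ.<-≤-trans i<s s≤t)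

∣called∣ : ∀ {t} {σ : Vec (Fin n) n} → Unique σ → t ≤ n → ∣ called σ t ∣ ≡ t
∣called∣ {n} {t} {σ} σ! t≤n = begin
  ∣ called σ t ∣                  ≡⟨ ∣⋃∣≡length (UniqueList.take⁺ t (toList-unique σ!)) ⟩
  length (List.take t (toList σ)) ≡⟨ List.length-take t (toList σ) ⟩
  t ℕ.⊓ length (toList σ)         ≡⟨ cong (t ℕ.⊓_) (Vec.length-toList σ) ⟩
  t ℕ.⊓ n                         ≡⟨ ℕ.m≤n⇒m⊓n≡m t≤n ⟩
  t                               ∎
  where open ≡-Reasoning

-- A prefix of a repetition-free order has as many elements as rounds, so one inclusion already
-- forces equality.
called⊆⇒≡ : ∀ {σ : Vec (Fin n) n} {p} → Unique σ → called σ ∣ p ∣ ⊆ p → called σ ∣ p ∣ ≡ p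
called⊆⇒≡ {p = p} σ! called⊆p = ⊆-antisym called⊆p
  (p⊆q∧∣q∣≤∣p∣⇒q⊆p called⊆p (ℕ.≤-reflexive (sym (∣called∣ σ! (∣p∣≤n p)))))

called-map⁺ : ∀ t {f : Fin n → Fin n} (σ : Vec (Fin n) n) {x} →
              x ∈ called σ t → f x ∈ called (Vec.map f σ) t
called-map⁺ t {f} σ x∈ with i , i<t , refl ← called⁻ t σ x∈ =
  subst (_∈ _) (Vec.lookup-map i f σ) (called⁺ t (Vec.map f σ) i<t)

called-map⁻ : ∀ t {f : Fin n → Fin n} (σ : Vec (Fin n) n) {p : Subset n} →
              (∀ {x} → x ∈ called σ t → f x ∈ p) → called (Vec.map f σ) t ⊆ p
called-map⁻ t {f} σ maps x∈ with i , i<t , refl ← called⁻ t (Vec.map f σ) x∈ =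
  subst (_∈ _) (sym (Vec.lookup-map i f σ)) (maps (called⁺ t σ i<t))

-- Relabellings

find-inside : (p : Subset n) → 0 < ∣ p ∣ → ∃ λ i → lookup p i ≡ inside
find-inside (inside  ∷ p) _     = zero , refl
find-inside (outside ∷ p) 0<∣p∣ with i , eq ← find-inside p 0<∣p∣ = suc i , eq

find-outside : (p : Subset n) → ∣ p ∣ < n → ∃ λ i → lookup p i ≡ outside
find-outside (outside ∷ p) _     = zero , refl
find-outside (inside  ∷ p) ∣p∣<n with i , eq ← find-outside p (s<s⁻¹ ∣p∣<n) = suc i , eq

-- For `s = outside`, `∣ p ∣ ≤ n` leaves `q` short of all `suc n` positions, so some position is
-- missed.
find-head : ∀ s (p : Subset n) (q : Subset (suc n)) → ∣ s ∷ p ∣ ≡ ∣ q ∣ →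
            ∃ λ i → lookup q i ≡ s
find-head inside  p q eq = find-inside q (subst (0 <_) eq (s≤s z≤n))
find-head outside p q eq = find-outside q (subst (_< _) eq (s≤s (∣p∣≤n p)))

∣∷∣-cong : ∀ s (p q : Subset n) → ∣ p ∣ ≡ ∣ q ∣ → ∣ s ∷ p ∣ ≡ ∣ s ∷ q ∣
∣∷∣-cong inside  p q = cong suc
∣∷∣-cong outside p q = id

∣∷∣-swap : ∀ s t (p : Subset n) → ∣ s ∷ t ∷ p ∣ ≡ ∣ t ∷ s ∷ p ∣
∣∷∣-swap inside  inside  p = refl
∣∷∣-swap inside  outside p = refl
∣∷∣-swap outside inside  p = refl
∣∷∣-swap outside outside p = refl

∣lookup∷removeAt∣ : ∀ (q : Subset (suc n)) i → ∣ lookup q i ∷ removeAt q i ∣ ≡ ∣ q ∣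
∣lookup∷removeAt∣ (s ∷ q)         zero    = refl
∣lookup∷removeAt∣ (s ∷ q@(_ ∷ _)) (suc i) =
  trans (∣∷∣-swap (lookup q i) s (removeAt q i))
    (∣∷∣-cong s (lookup q i ∷ removeAt q i) q (∣lookup∷removeAt∣ q i))

∣∷∣-cancel : ∀ s (p q : Subset n) → ∣ s ∷ p ∣ ≡ ∣ s ∷ q ∣ → ∣ p ∣ ≡ ∣ q ∣
∣∷∣-cancel inside  p q eq = ℕ.suc-injective eq
∣∷∣-cancel outside p q eq = eq

lookup-punchIn : ∀ {A : Set} (xs : Vec A (suc n)) i j →
                 lookup xs (punchIn i j) ≡ lookup (removeAt xs i) j
lookup-punchIn (x ∷ xs) zero j = refl
lookup-punchIn (x ∷ _ ∷ _)     (suc i) zero    = refl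
lookup-punchIn (x ∷ xs@(_ ∷ _)) (suc i) (suc j) = lookup-punchIn xs i j

-- Induction on `p`: position `zero` goes to some `j` on the same side of `q`, and the rest goes
-- through `punchIn j` into `q` with `j` removed, where the cardinalities still agree. Preserving
-- both sides, not just membership, lets the recursion treat inside and outside positions alike.
relabelling : (p q : Subset n) → ∣ p ∣ ≡ ∣ q ∣ →
  ∃ λ (f : Fin n → Fin n) → Injective _≡_ _≡_ f × (∀ i → lookup q (f i) ≡ lookup p i)
relabelling []      []  _  = id , id , λ ()
relabelling (s ∷ p) q   eq with j , refl ← find-head s p q eq
  with f , f-inj , f-pres ← relabelling p (removeAt q j)
         (∣∷∣-cancel (lookup q j) p (removeAt q j) (trans eq (sym (∣lookup∷removeAt∣ q j))))
  = g , g-inj , g-pres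
  where
  g : Fin _ → Fin _
  g zero    = j
  g (suc i) = punchIn j (f i)

  g-inj : Injective _≡_ _≡_ g
  g-inj {zero}  {zero}  _  = refl
  g-inj {zero}  {suc _} eq = contradiction (sym eq) (Fin.punchInᵢ≢i j _)
  g-inj {suc _} {zero}  eq = contradiction eq (Fin.punchInᵢ≢i j _)
  g-inj {suc _} {suc _} eq = cong suc (f-inj (Fin.punchIn-injective j _ _ eq))

  g-pres : ∀ i → lookup q (g i) ≡ lookup (lookup q j ∷ p) i
  g-pres zero    = refl
  g-pres (suc i) = trans (lookup-punchIn q j (f i)) (f-pres i)

relabelling-⊆ : (p q : Subset n) → ∣ p ∣ ≡ ∣ q ∣ →
  ∃ λ (f : Fin n → Fin n) → Injective _≡_ _≡_ f × (∀ {i} → i ∈ p → f i ∈ q)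
relabelling-⊆ p q eq with f , f-inj , f-pres ← relabelling p q eq =
  f , f-inj , λ {i} i∈p →
    Vec.lookup⇒[]= (f i) q (trans (f-pres i) (Vec.[]=⇒lookup i∈p))

map-injective : ∀ {A B : Set} {f : A → B} → Injective _≡_ _≡_ f →
                ∀ {m} → Injective _≡_ _≡_ (Vec.map {n = m} f)
map-injective f-inj {_} {[]}     {[]}     _  = refl
map-injective f-inj {_} {x ∷ xs} {y ∷ ys} eq =
  cong₂ _∷_ (f-inj (Vec.∷-injectiveˡ eq)) (map-injective f-inj (Vec.∷-injectiveʳ eq))

transpose-injective : (i j : Fin n) → Injective _≡_ _≡_ (transpose i j)
transpose-injective i j {x} {y} eq = begin
  x                                 ≡⟨ transpose-inverse j i ⟨
  transpose j i (transpose i j x)   ≡⟨ cong (transpose j i) eq ⟩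
  transpose j i (transpose i j y)   ≡⟨ transpose-inverse j i ⟩
  y                                 ∎
  where open ≡-Reasoning

transpose-fixes : ∀ {i j k : Fin n} → k ≢ i → k ≢ j → transpose i j k ≡ k
transpose-fixes {i = i} {j} {k} k≢i k≢j with k Fin.≟ i
... | yes k≡i = contradiction k≡i k≢i
... | no _ with k Fin.≟ j
...   | yes k≡j = contradiction k≡j k≢j
...   | no _ = refl

transpose-left : (i j : Fin n) → transpose i j i ≡ j
transpose-left i j with i Fin.≟ i
... | yes _ = refl
... | no i≢i = contradiction refl i≢i

-- The identity order is relabelled by an injection that carries its first `∣ p ∣` values into `p`.
orderStartingWith : (p : Subset n) →
  ∃ λ (σ : Vec (Fin n) n) → Unique σ × called σ ∣ p ∣ ≡ p
orderStartingWith {n} p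
  with f , f-inj , maps ← relabelling-⊆ (called (Vec.allFin n) ∣ p ∣) p
         (∣called∣ (Unique.tabulate⁺ id) (∣p∣≤n p))
  = Vec.map f (Vec.allFin n) , σ! ,
    called⊆⇒≡ σ! (called-map⁻ ∣ p ∣ (Vec.allFin n) maps)
  where
  σ! = Unique.map⁺ f-inj (Unique.tabulate⁺ id)

-- In an order that starts with `p`, the element called next is swapped with `x`. Neither of the two
-- lies in `p`, so the prefix is undisturbed.
orderStartingWith∷ : (p : Subset n) {x : Fin n} → x ∉ p →
  ∃ λ (σ : Vec (Fin n) n) → Unique σ × called σ ∣ p ∣ ≡ p × x ∈ called σ (suc ∣ p ∣)
orderStartingWith∷ {n} p {x} x∉p with σ , σ! , eq ← orderStartingWith p =
  τ , τ! ,
  called⊆⇒≡ τ! called⊆p ,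
  subst (_∈ called τ (suc ∣ p ∣)) (transpose-left y x)
    (called-map⁺ (suc ∣ p ∣) σ (called⁺ (suc ∣ p ∣) σ (s≤s (ℕ.≤-reflexive (Fin.toℕ-fromℕ< ∣p∣<n)))))
  where
  ∣p∣<n : ∣ p ∣ < n
  ∣p∣<n = subst (_≤ n) (∣p∪⁅x⁆∣≡1+∣p∣ x∉p) (∣p∣≤n (p ∪ ⁅ x ⁆))

  -- Positions count from zero, so this is the element called in round `suc ∣ p ∣`.
  y = lookup σ (fromℕ< ∣p∣<n)

  y∉called : y ∉ called σ ∣ p ∣
  y∉called y∈ with i , i<∣p∣ , σi≡y ← called⁻ ∣ p ∣ σ y∈ =
    ℕ.<⇒≢ i<∣p∣ (trans (cong toℕ (Unique.lookup-injective σ! _ _ σi≡y)) (Fin.toℕ-fromℕ< ∣p∣<n))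

  τ = Vec.map (transpose y x) σ
  τ! = Unique.map⁺ (transpose-injective y x) σ!

  called⊆p : called τ ∣ p ∣ ⊆ p
  called⊆p = called-map⁻ ∣ p ∣ σ λ {z} z∈ →
    let z∈p = subst (z ∈_) eq z∈ in
    subst (_∈ p) (sym (transpose-fixes (λ { refl → y∉called z∈ }) (λ { refl → x∉p z∈p }))) z∈p

-- Matroids

module MatroidProperties (M : Matroid n) where
  open Matroid M hiding (HasRank; IsCircuit)

  -- Descent through dependent proper subsets terminates at a minimal dependent set, which is a
  -- circuit.
  dependent⇒containsCircuit : ∀ S → ¬ Indep S → ContainsCircuit S
  dependent⇒containsCircuit S = go (⊂-wellFounded S)
    where
    go : ∀ {S} → Acc _⊂_ S → ¬ Indep S → ContainsCircuit S
    go {S} (acc rec) ¬IS with anySubset? (λ D → (D ⊂? S) ×-dec ¬? (indep? D))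
    ... | yes (D , D⊂S , ¬ID) with C , circ , C⊆D ← go (rec D⊂S) ¬ID =
      C , circ , ⊆-trans C⊆D (proj₁ D⊂S)
    ... | no none = S , (¬IS , λ {D} D⊂S → decidable-stable (indep? D) λ ¬ID → none (D , D⊂S , ¬ID)) , ⊆-refl

  -- Augmentation from `J` is repeated `d` times. The bound `K ⊆ I ∪ J` records where the new
  -- elements come from; this later confines a basis to a prescribed set.
  extend : ∀ d {I J} → Indep I → Indep J → d ℕ.+ ∣ I ∣ ≡ ∣ J ∣ →
           ∃ λ K → I ⊆ K × K ⊆ I ∪ J × Indep K × ∣ K ∣ ≡ ∣ J ∣
  extend zero    {I} {J} II IJ eq = I , ⊆-refl , p⊆p∪q J , II , eq
  extend (suc d) {I} {J} II IJ eq
    with e , e∈J , e∉I , IIe ← augment II IJ (subst (∣ I ∣ <_) eq (s≤s (ℕ.m≤n+m ∣ I ∣ d)))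
    with K , Ie⊆K , K⊆ , IK , ∣K∣ ← extend d IIe IJ
           (trans (cong (d ℕ.+_) (∣p∪⁅x⁆∣≡1+∣p∣ e∉I)) (trans (ℕ.+-suc d ∣ I ∣) eq))
    = K , Ie⊆K ∘ p⊆p∪q ⁅ e ⁆ , shrink ∘ K⊆ , IK , ∣K∣
    where
    shrink : (I ∪ ⁅ e ⁆) ∪ J ⊆ I ∪ J
    shrink x∈ with x∈p∪q⁻ (I ∪ ⁅ e ⁆) J x∈
    ... | inj₂ x∈J  = x∈p∪q⁺ (inj₂ x∈J)
    ... | inj₁ x∈Ie with x∈p∪q⁻ I ⁅ e ⁆ x∈Ie
    ...   | inj₁ x∈I = x∈p∪q⁺ (inj₁ x∈I)
    ...   | inj₂ x∈e with refl ← x∈⁅y⁆⇒x≡y e x∈e = x∈p∪q⁺ (inj₂ e∈J)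

  -- A larger independent set would augment the basis `B`, against its maximality.
  indep⇒∣∣≤rank : ∀ {r I} → HasRank M r → Indep I → ∣ I ∣ ≤ r
  indep⇒∣∣≤rank (B , (IB , max) , refl) II = ℕ.≮⇒≥ λ ∣B∣<∣I∣ →
    let e , _ , e∉B , IBe = augment IB II ∣B∣<∣I∣ in
    max (p⊆p∪q ⁅ e ⁆ , e , q⊆p∪q B ⁅ e ⁆ (x∈⁅x⁆ e) , e∉B) IBe

  circuit-nonempty : ∀ {C} → IsCircuit M C → Nonempty C
  circuit-nonempty {C} (¬IC , _) = decidable-stable (nonempty? C) λ empty →
    ¬IC (subst Indep (sym (Empty-unique empty)) ⊥-indep)

  circuit-⊆⇒⊇ : ∀ {C D} → IsCircuit M C → IsCircuit M D → C ⊆ D → D ⊆ C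
  circuit-⊆⇒⊇ {C} (¬IC , _) (_ , min) C⊆D {x} x∈D = decidable-stable (x ∈? C)
    λ x∉C → ¬IC (min (C⊆D , x , x∈D , x∉C))

  -- By minimality of the circuit, `C - f` is independent and can be grown to size `r` with elements
  -- of `I`. The result avoids `f`, since otherwise it would contain all of `C`.
  extend-circuit-minus : ∀ {r I C f} → IsCircuit M C → f ∈ C → Indep I → ∣ I ∣ ≡ r → HasRank M r →
    ∃ λ K → C - f ⊆ K × K ⊆ (C - f) ∪ I × f ∉ K × Indep K × ∣ K ∣ ≡ r
  extend-circuit-minus {I = I} {C} {f} (¬IC , min) f∈C II refl hasRank
    with K , C-f⊆K , K⊆ , IK , ∣K∣ ← extend (∣ I ∣ ∸ ∣ C - f ∣) (min (x∈p⇒p-x⊂p f∈C)) II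
           (ℕ.m∸n+n≡m (indep⇒∣∣≤rank hasRank (min (x∈p⇒p-x⊂p f∈C))))
    = K , C-f⊆K , K⊆ , (λ f∈K → ¬IC (⊆-indep (p-x⊆q⇒p⊆q f∈K C-f⊆K) IK)) , IK , ∣K∣

  -- `S` is a basis `I` containing `C - e`, together with `e`; thus `C` is the fundamental circuit
  -- of `e` with respect to `I`.
  spanning-unicyclic-extension : ∀ {r C} → HasRank M r → IsCircuit M C →
    ∃ λ S → C ⊆ S × ∣ S ∣ ≡ suc r × (∀ {f} → f ∈ C → Indep (S - f))
  spanning-unicyclic-extension {r} {C} hasRank@(B , (IB , _) , ∣B∣≡r) circ
    with e , e∈C ← circuit-nonempty circ
    with I , C-e⊆I , _ , e∉I , II , ∣I∣≡r ← extend-circuit-minus circ e∈C IB ∣B∣≡r hasRank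
    = S , C⊆S , ∣S∣≡1+r , deletion
    where
    S = I ∪ ⁅ e ⁆

    C⊆S : C ⊆ S
    C⊆S = p-x⊆q⇒p⊆q (q⊆p∪q I ⁅ e ⁆ (x∈⁅x⁆ e)) (p⊆p∪q ⁅ e ⁆ ∘ C-e⊆I)

    ∣S∣≡1+r : ∣ S ∣ ≡ suc r
    ∣S∣≡1+r = trans (∣p∪⁅x⁆∣≡1+∣p∣ e∉I) (cong suc ∣I∣≡r)

    -- Growing `C - f` by elements of `I` gives an independent `K` of size `r` inside `S - f`. As
    -- `S - f` has at most `r` elements, it is contained in `K`.
    deletion : ∀ {f} → f ∈ C → Indep (S - f)
    deletion {f} f∈C
      with K , _ , K⊆ , f∉K , IK , ∣K∣≡r ← extend-circuit-minus circ f∈C II ∣I∣≡r hasRank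
      = ⊆-indep (p⊆q∧∣q∣≤∣p∣⇒q⊆p K⊆S-f ∣S-f∣≤∣K∣) IK
      where
      K⊆S-f : K ⊆ S - f
      K⊆S-f x∈K = x∈p∧x≢y⇒x∈p-y
        ([ C⊆S ∘ p─q⊆p C _ , p⊆p∪q ⁅ e ⁆ ]′ (x∈p∪q⁻ (C - f) I (K⊆ x∈K)))
        λ { refl → f∉K x∈K }

      ∣S-f∣≤∣K∣ : ∣ S - f ∣ ≤ ∣ K ∣
      ∣S-f∣≤∣K∣ = ℕ.≤-trans
        (s≤s⁻¹ (subst (∣ S - f ∣ <_) ∣S∣≡1+r (x∈p⇒∣p-x∣<∣p∣ (C⊆S f∈C))))
        (ℕ.≤-reflexive (sym ∣K∣≡r))

  -- Every circuit inside the prefix contains each `f ∈ C`, because deleting `f` leaves an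
  -- independent set. Hence no circuit is complete while `C` is not; the recursion steps back to the
  -- round that completes `C`.
  prefix-wins : ∀ {C σ} t → t ≤ n → IsCircuit M C → C ⊆ called σ t →
                (∀ {f} → f ∈ C → Indep (called σ t - f)) → Wins M C σ
  prefix-wins zero _ (¬IC , _) C⊆ _ = contradiction (⊆-indep C⊆ ⊥-indep) ¬IC
  prefix-wins {C} {σ} (suc t) t<n circ C⊆ deletion with C ⊆? called σ t
  ... | yes C⊆′ = prefix-wins t (ℕ.<⇒≤ t<n) circ C⊆′
          λ f∈C → ⊆-indep (-y-mono-⊆ _ (called-mono σ (ℕ.n≤1+n t))) (deletion f∈C)
  ... | no C⊈ = fromℕ< t<n , subst (λ s → C ⊆ called σ (suc s) × ¬ ContainsCircuit (called σ s))
                  (sym (Fin.toℕ-fromℕ< t<n)) (C⊆ , none)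
    where
    none : ¬ ContainsCircuit (called σ t)
    -- If some `f ∈ C` were still uncalled, `D` would lie in the next prefix minus `f`, which is
    -- independent.
    none (D , (¬ID , _) , D⊆) = C⊈ λ {f} f∈C → decidable-stable (f ∈? called σ t) λ f∉ →
      ¬ID (⊆-indep (λ x∈D → x∈p∧x≢y⇒x∈p-y (called-mono σ (ℕ.n≤1+n t) (D⊆ x∈D))
                                (λ { refl → f∉ (D⊆ x∈D) }))
                   (deletion f∈C))

  -- Before the winning round the called set contains no circuit, so it is independent and has at
  -- most `r` elements. After that round it contains the `suc r` elements of `C`. Both bounds
  -- together leave room for nothing else.
  spanning-circuit-wins⇒called : ∀ {r C σ} → HasRank M r → ∣ C ∣ ≡ suc r →
    Unique σ → Wins M C σ → called σ (suc r) ≡ C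
  spanning-circuit-wins⇒called {r} {C} {σ} hasRank ∣C∣≡1+r σ! (i , C⊆ , none) =
    trans (cong (called σ ∘ suc) (sym i≡r))
          (⊆-antisym (p⊆q∧∣q∣≤∣p∣⇒q⊆p C⊆ (ℕ.≤-reflexive ∣called∣≡∣C∣)) C⊆)
    where
    ∣called-1+i∣ : ∣ called σ (suc (toℕ i)) ∣ ≡ suc (toℕ i)
    ∣called-1+i∣ = ∣called∣ σ! (Fin.toℕ<n i)

    i≤r : toℕ i ≤ r
    i≤r = subst (_≤ r) (∣called∣ σ! (ℕ.<⇒≤ (Fin.toℕ<n i)))
      (indep⇒∣∣≤rank hasRank (decidable-stable (indep? _) (none ∘ dependent⇒containsCircuit _)))

    r≤i : r ≤ toℕ i
    r≤i = s≤s⁻¹ (subst (_≤ suc (toℕ i)) ∣C∣≡1+r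
      (subst (∣ C ∣ ≤_) ∣called-1+i∣ (p⊆q⇒∣p∣≤∣q∣ C⊆)))

    i≡r : toℕ i ≡ r
    i≡r = ℕ.≤-antisym i≤r r≤i

    ∣called∣≡∣C∣ : ∣ called σ (suc (toℕ i)) ∣ ≡ ∣ C ∣
    ∣called∣≡∣C∣ = trans ∣called-1+i∣ (trans (cong suc i≡r) (sym ∣C∣≡1+r))

-- Counting

module _ {A : Set} where

  lookup-injective : ∀ {xs : List A} → UniqueList xs → Injective _≡_ _≡_ (List.lookup xs)
  lookup-injective (px ∷ xs!) {zero}  {zero}  _  = refl
  lookup-injective (px ∷ xs!) {zero}  {suc j} eq = contradiction eq (All.lookup px (∈-lookup j))
  lookup-injective (px ∷ xs!) {suc i} {zero}  eq = contradiction (sym eq) (All.lookup px (∈-lookup i))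
  lookup-injective (px ∷ xs!) {suc i} {suc j} eq = cong suc (lookup-injective xs! eq)

  -- Each index of `xs` is sent to the index of an occurrence in `ys`; equal images mean equal
  -- entries, hence equal indices in the repetition-free `xs`.
  unique-⊆⇒length≤ : ∀ {xs ys : List A} → UniqueList xs → xs ⊆ᴸ ys → length xs ≤ length ys
  unique-⊆⇒length≤ {xs} {ys} xs! xs⊆ys = Fin.injective⇒≤ {f = λ i → Any.index (position i)} λ {i} {j} eq →
    lookup-injective xs! (begin
      List.lookup xs i                       ≡⟨ lookup-index (position i) ⟩
      List.lookup ys (Any.index (position i)) ≡⟨ cong (List.lookup ys) eq ⟩
      List.lookup ys (Any.index (position j)) ≡⟨ lookup-index (position j) ⟨
      List.lookup xs j                       ∎)
    where
    open ≡-Reasoning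
    position : ∀ i → List.lookup xs i ListMem.∈ ys
    position i = xs⊆ys (∈-lookup i)

-- Adjoining the missed `y` to the image of `xs` gives a repetition-free list, one longer than `xs`,
-- with all entries in `ys`.
injection-missing⇒length< : ∀ {A B : Set} {f : A → B} {xs : List A} {ys : List B} {y} →
  Injective _≡_ _≡_ f → UniqueList xs → (∀ {x} → x ListMem.∈ xs → f x ListMem.∈ ys) →
  y ListMem.∈ ys → (∀ {x} → x ListMem.∈ xs → y ≢ f x) → length xs < length ys
injection-missing⇒length< {f = f} {xs} {ys} {y} f-inj xs! maps y∈ys missed =
  subst (λ l → suc l ≤ length ys) (List.length-map f xs)
    (unique-⊆⇒length≤ (map⁺ (All.tabulate missed) ∷ UniqueList.map⁺ f-inj xs!) ⊆ys)
  where
  ⊆ys : (y ∷ List.map f xs) ⊆ᴸ ys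
  ⊆ys (here refl) = y∈ys
  ⊆ys (there z∈) with _ , x∈xs , refl ← ∈-map⁻ f z∈ = maps x∈xs

-- Normalisation in `ℚ` may reduce the two fractions differently; among unnormalised rationals both
-- keep the denominator `d`, and cross-multiplication compares the numerators.
/-monoˡ-< : ∀ {a b} d .{{_ : NonZero d}} → a < b → ℤ.+ a ℚ./ d ℚ.< ℤ.+ b ℚ./ d
/-monoˡ-< {a} {b} d@(suc d-1) a<b = ℚ.toℚᵘ-cancel-< (begin-strict
  ℚ.toℚᵘ (ℤ.+ a ℚ./ d)  ≃⟨ ℚ.toℚᵘ-fromℚᵘ (ℚᵘ.mkℚᵘ (ℤ.+ a) d-1) ⟩
  ℚᵘ.mkℚᵘ (ℤ.+ a) d-1   <⟨ ℚᵘ.*<* (ℤ.*-monoʳ-<-pos (ℤ.+ d) (ℤ.+<+ a<b)) ⟩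
  ℚᵘ.mkℚᵘ (ℤ.+ b) d-1   ≃⟨ ℚ.toℚᵘ-fromℚᵘ (ℚᵘ.mkℚᵘ (ℤ.+ b) d-1) ⟨
  ℚ.toℚᵘ (ℤ.+ b ℚ./ d)  ∎)
  where open ℚᵘ.≤-Reasoning

-- Comparing the orders won by the two circuits

ordersWonBy : Matroid n → Subset n → List (Vec (Fin n) n)
ordersWonBy M C = filter (wins? M C) (orders _)

∈-ordersWonBy⁻ : ∀ {M : Matroid n} {C σ} → σ ListMem.∈ ordersWonBy M C → Unique σ × Wins M C σ
∈-ordersWonBy⁻ {n} {M} {C} σ∈ with σ∈orders , wins ← ∈-filter⁻ (wins? M C) {xs = orders n} σ∈ =
  ∈-orders⁻ σ∈orders , wins

∈-ordersWonBy⁺ : ∀ {M : Matroid n} {C σ} → Unique σ → Wins M C σ → σ ListMem.∈ ordersWonBy M C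
∈-ordersWonBy⁺ {M = M} {C} σ! = ∈-filter⁺ (wins? M C) (∈-orders⁺ σ!)

spanning-circuit-wins-less : ∀ (M : Matroid n) {r} → HasRank M r →
  ∀ {C₁ C₂} → IsCircuit M C₁ → IsCircuit M C₂ → ∣ C₁ ∣ ≡ suc r → ∣ C₂ ∣ < suc r →
  length (ordersWonBy M C₁) < length (ordersWonBy M C₂)
spanning-circuit-wins-less {n} M {r} hasRank {C₁} {C₂} circ₁ circ₂ ∣C₁∣≡1+r ∣C₂∣<1+r
  with S , C₂⊆S , ∣S∣≡1+r , deletion ←
         MatroidProperties.spanning-unicyclic-extension M hasRank circ₂
  with f , f-inj , maps ← relabelling-⊆ C₁ S
         (trans ∣C₁∣≡1+r (sym ∣S∣≡1+r))
  = injection-missing⇒length< (map-injective f-inj)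
        (UniqueList.filter⁺ (wins? M C₁) (orders-unique n))
        (λ σ∈ → let σ! , wins₁ = ∈-ordersWonBy⁻ {M = M} σ∈ in
          ∈-ordersWonBy⁺ {M = M} (Unique.map⁺ f-inj σ!) (relabelled-wins σ! wins₁))
        (∈-ordersWonBy⁺ {M = M} τ! τ-wins)
        -- Every relabelled order calls only elements of `S` in its first `suc r` rounds, whereas
        -- `τ` calls `x` among them.
        λ {σ} σ∈ τ≡ → let σ! , wins₁ = ∈-ordersWonBy⁻ {M = M} σ∈ in
          x∉S (relabelled-called⊆S σ! wins₁ (subst (λ σ → x ∈ called σ (suc r)) τ≡ x∈called))
  where
  open Matroid M using (⊆-indep)
  open MatroidProperties M

  1+r≤n : suc r ≤ n
  1+r≤n = subst (_≤ n) ∣C₁∣≡1+r (∣p∣≤n C₁)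

  -- Otherwise equal cardinalities give `S ⊆ C₁`, so `C₂ ⊆ C₁`. Comparable circuits coincide, but
  -- `C₂` is smaller.
  C₁⊈S : ¬ C₁ ⊆ S
  C₁⊈S C₁⊆S = ℕ.<⇒≱ ∣C₂∣<1+r (subst (_≤ ∣ C₂ ∣) ∣C₁∣≡1+r (p⊆q⇒∣p∣≤∣q∣
    (circuit-⊆⇒⊇ circ₂ circ₁
      (p⊆q∧∣q∣≤∣p∣⇒q⊆p C₁⊆S (ℕ.≤-reflexive (trans ∣S∣≡1+r (sym ∣C₁∣≡1+r))) ∘ C₂⊆S))))

  outsider = ⊈⇒∃∉ C₁⊈S
  x = proj₁ outsider
  x∉S = proj₂ (proj₂ outsider)

  order = orderStartingWith∷ C₂ (x∉S ∘ C₂⊆S)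
  τ = proj₁ order
  τ! = proj₁ (proj₂ order)
  τ-start = proj₁ (proj₂ (proj₂ order))

  -- `x` is called by round `suc ∣ C₂ ∣`, which is at most `suc r` because `C₂` is not
  -- spanning-sized.
  x∈called : x ∈ called τ (suc r)
  x∈called = called-mono τ ∣C₂∣<1+r (proj₂ (proj₂ (proj₂ order)))

  -- The prefix is `C₂` itself, so the deletion condition is the minimality of the circuit.
  τ-wins : Wins M C₂ τ
  τ-wins = prefix-wins ∣ C₂ ∣ (∣p∣≤n C₂) circ₂ (⊆-reflexive (sym τ-start))
    λ f∈C₂ → subst (λ p → Matroid.Indep M (p - _)) (sym τ-start) (proj₂ circ₂ (x∈p⇒p-x⊂p f∈C₂))

  relabelled-called⊆S : ∀ {σ} → Unique σ → Wins M C₁ σ → called (Vec.map f σ) (suc r) ⊆ S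
  relabelled-called⊆S {σ} σ! wins₁ = called-map⁻ (suc r) σ λ y∈ →
    maps (subst (_ ∈_) (spanning-circuit-wins⇒called hasRank ∣C₁∣≡1+r σ! wins₁) y∈)

  -- The first `suc r` relabelled calls lie in `S` and equal it in number, so they exhaust `S` and
  -- in particular include `C₂`.
  relabelled-wins : ∀ {σ} → Unique σ → Wins M C₁ σ → Wins M C₂ (Vec.map f σ)
  relabelled-wins σ! wins₁ = prefix-wins (suc r) 1+r≤n circ₂
    (p⊆q∧∣q∣≤∣p∣⇒q⊆p called⊆S
      (ℕ.≤-reflexive (trans ∣S∣≡1+r (sym (∣called∣ (Unique.map⁺ f-inj σ!) 1+r≤n)))) ∘ C₂⊆S)
    λ g∈C₂ → ⊆-indep (-y-mono-⊆ _ called⊆S) (deletion g∈C₂)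
    where called⊆S = relabelled-called⊆S σ! wins₁

corollary7 : ∀ {n : ℕ} (M : Matroid n) {r : ℕ} → HasRank M r →
    ∀ {C₁ C₂ : Subset n} → IsCircuit M C₁ → IsCircuit M C₂ →
    ∣ C₁ ∣ ≡ r ℕ.+ 1 → ∣ C₂ ∣ ℕ.< r ℕ.+ 1 →
    β M C₁ ℚ.< β M C₂
corollary7 {n} M {r} hasRank {C₁} {C₂} circ₁ circ₂ ∣C₁∣≡r+1 ∣C₂∣<r+1 =
  -- Both probabilities have the number of all orders as denominator, so the counts decide.
  /-monoˡ-< {length (ordersWonBy M C₁)} {length (ordersWonBy M C₂)} (length (orders n)) {{orders-nonZero n}}
    (spanning-circuit-wins-less M hasRank circ₁ circ₂
      (trans ∣C₁∣≡r+1 (ℕ.+-comm r 1)) (subst (∣ C₂ ∣ <_) (ℕ.+-comm r 1) ∣C₂∣<r+1))
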